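{- For every integer $r\ge 4$, $f_r(r+1,r)=\rho_r\big(T_r(r+2)\big)=\dfrac{4}{r+2}$.
   Context: All graphs are finite and simple. For integers $\Delta,\omega$, let $\mathcal{G}(\Delta,\omega)$ be the class of graphs $G$ with maximum degree $\Delta(G)\le\Delta$ and clique number $\omega(G)\le\omega$. For a graph $G$, $k_t(G)$ denotes the number of copies of $K_t$ in $G$, and $\rho_t(G)=k_t(G)/|V(G)|$. For a positive integer $n$ let $k_t(n,\Delta,\omega)=\max\{k_t(G): |V(G)|=n,\ G\in\mathcal{G}(\Delta,\omega)\}$, and define $f_t(\Delta,\omega)=\lim_{n\to\infty}k_t(n,\Delta,\omega)/n$ (this limit exists and equals $\sup_{n}k_t(n,\Delta,\omega)/n$). $T_r(n)$ denotes the Turán graph: the complete $r$-partite graph on $n$ vertices whose part sizes differ by at most one. -}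

module Defs where

open import Data.Bool using (Bool; true; false; not; _∧_; _∨_; T)
open import Data.Nat using (ℕ; zero; suc; _≤_; _%_; _≡ᵇ_; NonZero)
open import Data.Nat.Properties using (≡ᵇ⇒≡; ≡⇒≡ᵇ)
open import Data.Fin using (Fin; toℕ; _≟_)
open import Data.Fin.Subset using (Subset; ∣_∣)
open import Data.Vec using (Vec; []; _∷_; lookup)
open import Data.List using (List; []; _∷_; map; _++_; length; filterᵇ; concatMap; allFin)
open import Data.Bool.ListAction using (and)
open import Data.Integer using (+_)
open import Data.Rational using (ℚ; _/_)
open import Data.Product using (_×_)
open import Relation.Nullary using (does)
open import Relation.Binary.PropositionalEquality using (_≡_; refl; sym; cong)

record Graph (n : ℕ) : Set where
  field
    adj    : Fin n → Fin n → Bool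
    adj-sym    : ∀ i j → adj i j ≡ adj j i
    adj-irrefl : ∀ i → adj i i ≡ false
open Graph public

deg : ∀ {n} → Graph n → Fin n → ℕ
deg {n} G v = length (filterᵇ (adj G v) (allFin n))

allSubsets : (n : ℕ) → List (Subset n)
allSubsets zero = [] ∷ []
allSubsets (suc n) = map (true ∷_) (allSubsets n) ++ map (false ∷_) (allSubsets n)

isCliqueᵇ : ∀ {n} → Graph n → Subset n → Bool
isCliqueᵇ {n} G S =
  and (concatMap (λ i → map (λ j → not (lookup S i ∧ lookup S j) ∨ does (i ≟ j) ∨ adj G i j) (allFin n)) (allFin n))

IsClique : ∀ {n} → Graph n → Subset n → Set
IsClique G S = isCliqueᵇ G S ≡ true

k : ∀ {n} → ℕ → Graph n → ℕ
k {n} t G = length (filterᵇ (λ S → (∣ S ∣ ≡ᵇ t) ∧ isCliqueᵇ G S) (allSubsets n))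

ρ : ∀ {n} .{{_ : NonZero n}} → ℕ → Graph n → ℚ
ρ {n} t G = (+ k t G) / n

InClass : ∀ {n} → ℕ → ℕ → Graph n → Set
InClass {n} Δ ω G = (∀ v → deg G v ≤ Δ) × (∀ S → IsClique G S → ∣ S ∣ ≤ ω)

-- Turán graph T_r(n): vertex i lies in part (i mod r); adjacent iff different parts.
-- Part sizes differ by at most one.
private
  ≡ᵇ-sym : ∀ a b → (a ≡ᵇ b) ≡ (b ≡ᵇ a)
  ≡ᵇ-sym zero zero = refl
  ≡ᵇ-sym zero (suc b) = refl
  ≡ᵇ-sym (suc a) zero = refl
  ≡ᵇ-sym (suc a) (suc b) = ≡ᵇ-sym a b

  ≡ᵇ-refl : ∀ a → (a ≡ᵇ a) ≡ true
  ≡ᵇ-refl zero = refl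
  ≡ᵇ-refl (suc a) = ≡ᵇ-refl a

turán : (r : ℕ) .{{_ : NonZero r}} → (n : ℕ) → Graph n
turán r n = record
  { adj = λ i j → not ((toℕ i % r) ≡ᵇ (toℕ j % r))
  ; adj-sym = λ i j → cong not (≡ᵇ-sym (toℕ i % r) (toℕ j % r))
  ; adj-irrefl = λ i → cong not (≡ᵇ-refl (toℕ i % r))
  }

{-# OPTIONS --safe #-}

-- Upper bound, in the exact form (r + 2) k_r(G) ≤ 4 n.  A set W with r + m vertices contains
-- at most 2^m copies of K_r: for m > 0 it is not a clique, and every clique in it misses one
-- end of a non-adjacent pair.  Taking W = N[v], a vertex v lies in d(v) ≤ 4 copies of K_r.  Give
-- each copy A the weight g(d(v)) from each v ∈ A, where g(1) = 4, g(2) = 2, g(3) = g(4) = 1; then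
-- v gives away at most 4 in total, and A receives at least r + 2 once it has a vertex with
-- d ≤ 1 or two vertices with d ≤ 2.  This is clear if all its vertices have d ≤ 2.  If v ∈ A has
-- d(v) ≥ 3, then N[v] = A ∪ {p, q}, and a degree analysis shows that every copy of K_r meeting A
-- contains v and so lies in N[v].  Choose x, y ∈ A with x non-adjacent to p and y to q: copies
-- through x lie in N[v] ∖ {p}, copies through y in N[v] ∖ {q}, and if x = y both apply.
--
-- Lower bound: disjoint copies of T_r(r+2), the last one truncated.

module Submission where

open import Defs
open import Data.Bool using (Bool; true; false; not; _∧_; _∨_; T?; if_then_else_)
import Data.Bool as Bool
open import Data.Bool.ListAction using (and)
open import Data.Bool.Properties using (T-≡; T-∧; ∧-conicalˡ; ∧-conicalʳ; ∨-zeroʳ; ∧-zeroʳ)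
open import Data.Empty using (⊥; ⊥-elim)
open import Data.Fin using (Fin; zero; suc; toℕ; fromℕ<; _≟_)
import Data.Fin.Properties as Fin
open import Data.Fin.Subset using (Subset; ∣_∣; _∈_; _∉_; _⊆_; _∪_; ⁅_⁆) renaming (_-_ to infixl 5 _∖_)
open import Data.Fin.Subset.Properties
open import Data.Integer as ℤ using (+_; +[1+_]; -[1+_])
import Data.Integer.Properties as ℤ
open import Data.List using (List; []; _∷_; map; _++_; length; filter; filterᵇ; concatMap;
  allFin; upTo; cartesianProduct)
import Data.List.Membership.DecPropositional as DecMembership
open import Data.List.Membership.Propositional using (find; lose) renaming (_∈_ to _∈ˡ_; _∉_ to _∉ˡ_)
open import Data.List.Membership.Propositional.Properties
import Data.List.Properties as List
open import Data.List.Relation.Unary.All as All using (All; []; _∷_)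
open import Data.List.Relation.Unary.AllPairs using ([]; _∷_)
open import Data.List.Relation.Unary.Any using (Any; here; there)
open import Data.List.Relation.Unary.Unique.Propositional using (Unique)
import Data.List.Relation.Unary.Unique.Propositional.Properties as Unique
import Data.Nat
open import Data.Nat as ℕ using (ℕ; zero; suc; z≤n; s≤s; _^_; _%_; _≡ᵇ_; NonZero)
open import Data.Nat.DivMod hiding (_/_; _%_)
open import Data.Nat.Divisibility using (n∣m*n)
open import Data.Nat.ListAction using (sum)
open import Data.Nat.ListAction.Properties using (sum-++)
open import Data.Nat.Properties as ℕ using (≡ᵇ⇒≡; ≡⇒≡ᵇ)
open import Data.Nat.Tactic.RingSolver using (solve-∀)
open import Data.Product using (_×_; _,_; proj₁; proj₂; Σ; ∃-syntax)
import Data.Rational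
open import Data.Rational as ℚ using (ℚ; mkℚ; 0ℚ; _/_; _<_; _-_; toℚᵘ)
import Data.Rational.Properties as ℚ
open import Data.Rational.Unnormalised as ℚᵘ using (mkℚᵘ; *≤*)
import Data.Rational.Unnormalised.Properties as ℚᵘ
open import Data.Sum using (_⊎_; inj₁; inj₂; swap)
open import Data.Vec using ([]; _∷_; here; there; lookup; tabulate)
open import Data.Vec.Properties using ([]=⇒lookup; lookup⇒[]=; lookup∘tabulate)
open import Function using (_∘_; id; const; Equivalence)
open import Relation.Binary.PropositionalEquality
open import Relation.Nullary using (¬_; Dec; yes; no; does; contradiction)
open import Relation.Nullary.Decidable using (¬?; _×-dec_; dec-true)

private
  variable
    X Y : Set
    n : ℕ

-- Counting with lists without repetition.

-- Induction on `xs`: its head is cut out of `ys` at one occurrence, and by uniqueness the tail of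
-- `xs` still embeds in what is left. Surplus entries of `ys` can only increase the right side,
-- since weights are natural numbers.
unique-⊆⇒sum≤ : (w : X → ℕ) {xs ys : List X} → Unique xs → (∀ {x} → x ∈ˡ xs → x ∈ˡ ys) →
                sum (map w xs) ℕ.≤ sum (map w ys)
unique-⊆⇒sum≤ w {xs = []} _ _ = z≤n
unique-⊆⇒sum≤ w {xs = x ∷ xs} (x∉xs ∷ u) sub with ∈-∃++ (sub (here refl))
... | as , bs , refl = begin
  w x ℕ.+ sum (map w xs)                           ≤⟨ ℕ.+-monoʳ-≤ (w x) (unique-⊆⇒sum≤ w u sub′) ⟩
  w x ℕ.+ sum (map w (as ++ bs))                   ≡⟨ cong (w x ℕ.+_) (sum-map-++ as bs) ⟩
  w x ℕ.+ (sum (map w as) ℕ.+ sum (map w bs))      ≡⟨ exchange (w x) (sum (map w as)) (sum (map w bs)) ⟩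
  sum (map w as) ℕ.+ (w x ℕ.+ sum (map w bs))      ≡⟨ sum-map-++ as (x ∷ bs) ⟨
  sum (map w (as ++ x ∷ bs))                       ∎
  where
  open ℕ.≤-Reasoning
  exchange : ∀ a b c → a ℕ.+ (b ℕ.+ c) ≡ b ℕ.+ (a ℕ.+ c)
  exchange = solve-∀
  sum-map-++ : ∀ as bs → sum (map w (as ++ bs)) ≡ sum (map w as) ℕ.+ sum (map w bs)
  sum-map-++ as bs = trans (cong sum (List.map-++ w as bs)) (sum-++ (map w as) (map w bs))
  sub′ : ∀ {y} → y ∈ˡ xs → y ∈ˡ as ++ bs
  sub′ y∈xs with ∈-++⁻ as (sub (there y∈xs))
  ... | inj₁ y∈as = ∈-++⁺ˡ y∈as
  ... | inj₂ (here refl) = contradiction refl (All.lookup x∉xs y∈xs)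
  ... | inj₂ (there y∈bs) = ∈-++⁺ʳ as y∈bs

length≡sum : (xs : List X) → length xs ≡ sum (map (const 1) xs)
length≡sum [] = refl
length≡sum (x ∷ xs) = cong suc (length≡sum xs)

unique-⊆⇒length≤ : {xs ys : List X} → Unique xs → (∀ {x} → x ∈ˡ xs → x ∈ˡ ys) →
                   length xs ℕ.≤ length ys
unique-⊆⇒length≤ {xs = xs} {ys} u sub =
  subst₂ ℕ._≤_ (sym (length≡sum xs)) (sym (length≡sum ys)) (unique-⊆⇒sum≤ (const 1) u sub)

-- Subsets of `Fin n` as duplicate-free lists.

members : Subset n → List (Fin n)
members [] = []
members (true ∷ S) = zero ∷ map suc (members S)
members (false ∷ S) = map suc (members S)

length-members : (S : Subset n) → length (members S) ≡ ∣ S ∣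
length-members [] = refl
length-members (true ∷ S) = cong suc (trans (List.length-map suc (members S)) (length-members S))
length-members (false ∷ S) = trans (List.length-map suc (members S)) (length-members S)

∈-members⁺ : {S : Subset n} {x : Fin n} → x ∈ S → x ∈ˡ members S
∈-members⁺ here = here refl
∈-members⁺ {S = true ∷ S} (there x∈S) = there (∈-map⁺ suc (∈-members⁺ x∈S))
∈-members⁺ {S = false ∷ S} (there x∈S) = ∈-map⁺ suc (∈-members⁺ x∈S)

∈-members⁻ : {S : Subset n} {x : Fin n} → x ∈ˡ members S → x ∈ S
∈-members⁻ {S = true ∷ S} (here refl) = here
∈-members⁻ {S = true ∷ S} (there x∈) with ∈-map⁻ suc x∈
... | y , y∈ , refl = there (∈-members⁻ y∈)
∈-members⁻ {S = false ∷ S} x∈ with ∈-map⁻ suc x∈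
... | y , y∈ , refl = there (∈-members⁻ y∈)

unique-members : (S : Subset n) → Unique (members S)
unique-members [] = []
unique-members (true ∷ S) =
  All.tabulate (λ { x∈ refl → contradiction (proj₂ (proj₂ (∈-map⁻ suc x∈))) λ () })
  ∷ Unique.map⁺ Fin.suc-injective (unique-members S)
unique-members (false ∷ S) = Unique.map⁺ Fin.suc-injective (unique-members S)

-- With its counterpart `∣∣≤length`, this reduces cardinality estimates to exhibiting explicit lists
-- of vertices.
unique⇒length≤∣∣ : {xs : List (Fin n)} {S : Subset n} → Unique xs → (∀ {x} → x ∈ˡ xs → x ∈ S) →
                   length xs ℕ.≤ ∣ S ∣
unique⇒length≤∣∣ {S = S} u sub =
  subst (_ ℕ.≤_) (length-members S) (unique-⊆⇒length≤ u (∈-members⁺ ∘ sub))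

∣∣≤length : {S : Subset n} {ys : List (Fin n)} → (∀ {x} → x ∈ S → x ∈ˡ ys) → ∣ S ∣ ℕ.≤ length ys
∣∣≤length {S = S} sub =
  subst (ℕ._≤ _) (length-members S) (unique-⊆⇒length≤ (unique-members S) (sub ∘ ∈-members⁻))

⊆∧∣∣≥⇒≡ : {S W : Subset n} → S ⊆ W → ∣ W ∣ ℕ.≤ ∣ S ∣ → S ≡ W
⊆∧∣∣≥⇒≡ {S = S} {W} S⊆W W≤S = ⊆-antisym S⊆W W⊆S
  where
  W⊆S : W ⊆ S
  W⊆S {x} x∈W with x ∈? S
  ... | yes x∈S = x∈S
  ... | no x∉S = contradiction W≤S (ℕ.<⇒≱ (p⊂q⇒∣p∣<∣q∣ (S⊆W , x , x∈W , x∉S)))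

∈-fromᵇ⁺ : {f : Fin n → Bool} {x : Fin n} → f x ≡ true → x ∈ tabulate f
∈-fromᵇ⁺ {f = f} {x} fx = lookup⇒[]= x (tabulate f) (trans (lookup∘tabulate f x) fx)

∈-fromᵇ⁻ : {f : Fin n → Bool} {x : Fin n} → x ∈ tabulate f → f x ≡ true
∈-fromᵇ⁻ {f = f} {x} x∈ = trans (sym (lookup∘tabulate f x)) ([]=⇒lookup x∈)

∈-allSubsets : (S : Subset n) → S ∈ˡ allSubsets n
∈-allSubsets [] = here refl
∈-allSubsets {suc n} (true ∷ S) = ∈-++⁺ˡ (∈-map⁺ (true ∷_) (∈-allSubsets S))
∈-allSubsets {suc n} (false ∷ S) =
  ∈-++⁺ʳ (map (true ∷_) (allSubsets n)) (∈-map⁺ (false ∷_) (∈-allSubsets S))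

unique-allSubsets : ∀ n → Unique (allSubsets n)
unique-allSubsets zero = [] ∷ []
unique-allSubsets (suc n) = Unique.++⁺
  (Unique.map⁺ (λ { refl → refl }) (unique-allSubsets n))
  (Unique.map⁺ (λ { refl → refl }) (unique-allSubsets n))
  λ (p , q) → case-disjoint p q
  where
  case-disjoint : ∀ {S} → S ∈ˡ map (true ∷_) (allSubsets n) → S ∈ˡ map (false ∷_) (allSubsets n) → ⊥
  case-disjoint p q with ∈-map⁻ (true ∷_) p | ∈-map⁻ (false ∷_) q
  ... | _ , _ , refl | _ , _ , ()

and⁺ : {bs : List Bool} → (∀ {b} → b ∈ˡ bs → b ≡ true) → and bs ≡ true
and⁺ {[]} h = refl
and⁺ {b ∷ bs} h = cong₂ _∧_ (h (here refl)) (and⁺ (h ∘ there))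

and⁻ : {bs : List Bool} → and bs ≡ true → ∀ {b} → b ∈ˡ bs → b ≡ true
and⁻ {b ∷ bs} h (here refl) = ∧-conicalˡ b (and bs) h
and⁻ {b ∷ bs} h (there b∈) = and⁻ (∧-conicalʳ b (and bs) h) b∈

-- Cliques, copies of K_t and closed neighbourhoods.

Clique : Graph n → Subset n → Set
Clique G S = ∀ {i j} → i ∈ S → j ∈ S → i ≢ j → adj G i j ≡ true

module _ (G : Graph n) where

  private
    entry : Subset n → Fin n → Fin n → Bool
    entry S i j = not (lookup S i ∧ lookup S j) ∨ does (i ≟ j) ∨ adj G i j

  Clique⇒IsClique : {S : Subset n} → Clique G S → IsClique G S
  Clique⇒IsClique {S} c = and⁺ λ b∈ → row (∈-concatMap⁻ (λ i → map (entry S i) (allFin n)) b∈)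
    where
    good : ∀ i j → entry S i j ≡ true
    good i j with lookup S i in i∈ | lookup S j in j∈ | i ≟ j
    ... | false | _     | _ = refl
    ... | true  | false | _ = refl
    ... | true  | true  | yes _ = refl
    ... | true  | true  | no i≢j = c (lookup⇒[]= i S i∈) (lookup⇒[]= j S j∈) i≢j
    row : ∀ {b} → Any (λ i → b ∈ˡ map (entry S i) (allFin n)) (allFin n) → b ≡ true
    row p with find p
    ... | i , _ , b∈ with ∈-map⁻ (entry S i) b∈
    ... | j , _ , refl = good i j

  IsClique⇒Clique : {S : Subset n} → IsClique G S → Clique G S
  IsClique⇒Clique {S} c {i} {j} i∈ j∈ i≢j = from (and⁻ c (∈-concatMap⁺ (λ i → map (entry S i) (allFin n))
      (lose (∈-allFin i) (∈-map⁺ (entry S i) (∈-allFin j)))))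
    where
    from : entry S i j ≡ true → adj G i j ≡ true
    from e rewrite []=⇒lookup i∈ | []=⇒lookup j∈ with i ≟ j
    ... | yes i≡j = contradiction i≡j i≢j
    ... | no _ = e

  nonadjacentPair : {S : Subset n} → ¬ Clique G S →
    ∃[ i ] ∃[ j ] i ∈ S × j ∈ S × i ≢ j × adj G i j ≡ false
  nonadjacentPair {S} ¬c with Fin.any? (λ i → Fin.any? (λ j →
    (i ∈? S) ×-dec ((j ∈? S) ×-dec (¬? (i ≟ j) ×-dec (adj G i j Bool.≟ false)))))
  ... | yes p = p
  ... | no ¬p = ⊥-elim (¬c λ {i} {j} i∈ j∈ i≢j → nf (λ f → ¬p (i , j , i∈ , j∈ , i≢j , f)))
    where
    nf : ∀ {b} → ¬ b ≡ false → b ≡ true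
    nf {true} _ = refl
    nf {false} h = contradiction refl h

  isKᵇ : ℕ → Subset n → Bool
  isKᵇ t S = (∣ S ∣ ≡ᵇ t) ∧ isCliqueᵇ G S

  -- The number `k t G` is by definition the length of this list, so bounds on it become inclusions
  -- between duplicate-free lists.
  cliques : ℕ → List (Subset n)
  cliques t = filterᵇ (isKᵇ t) (allSubsets n)

  IsK : ℕ → Subset n → Set
  IsK t S = ∣ S ∣ ≡ t × Clique G S

  ∈-cliques⁻ : ∀ {t S} → S ∈ˡ cliques t → IsK t S
  ∈-cliques⁻ {t} S∈ with Equivalence.to T-∧ (proj₂ (∈-filter⁻ (T? ∘ isKᵇ t) {xs = allSubsets n} S∈))
  ... | e , c = ≡ᵇ⇒≡ _ _ e , IsClique⇒Clique (Equivalence.to T-≡ c)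

  ∈-cliques⁺ : ∀ {t S} → IsK t S → S ∈ˡ cliques t
  ∈-cliques⁺ {t} {S} (e , c) = ∈-filter⁺ (T? ∘ isKᵇ t) (∈-allSubsets S)
    (Equivalence.from T-∧ (≡⇒≡ᵇ _ _ e , Equivalence.from T-≡ (Clique⇒IsClique c)))

  unique-cliques : ∀ t → Unique (cliques t)
  unique-cliques t = Unique.filter⁺ (T? ∘ isKᵇ t) (unique-allSubsets n)

  -- The closed neighbourhood N[v]: including `v` itself makes every clique through `v` a subset of
  -- it.
  nbhd : Fin n → Subset n
  nbhd v = tabulate (λ j → does (v ≟ j) ∨ adj G v j)

  self∈nbhd : ∀ v → v ∈ nbhd v
  self∈nbhd v = ∈-fromᵇ⁺ (cong (_∨ adj G v v) (dec-true (v ≟ v) refl))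

  adj⇒∈nbhd : ∀ {v j} → adj G v j ≡ true → j ∈ nbhd v
  adj⇒∈nbhd {v} {j} a = ∈-fromᵇ⁺ (trans (cong (does (v ≟ j) ∨_) a) (∨-zeroʳ (does (v ≟ j))))

  ∈nbhd⁻ : ∀ {v j} → j ∈ nbhd v → v ≡ j ⊎ adj G v j ≡ true
  ∈nbhd⁻ {v} {j} j∈ with ∈-fromᵇ⁻ j∈
  ... | e with v ≟ j
  ... | yes v≡j = inj₁ v≡j
  ... | no _ = inj₂ e

  ∣nbhd∣≤ : ∀ v → ∣ nbhd v ∣ ℕ.≤ suc (deg G v)
  ∣nbhd∣≤ v = ∣∣≤length {ys = v ∷ filterᵇ (adj G v) (allFin n)} λ x∈ → f (∈nbhd⁻ x∈)
    where
    f : ∀ {x} → v ≡ x ⊎ adj G v x ≡ true → x ∈ˡ v ∷ filterᵇ (adj G v) (allFin n)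
    f (inj₁ refl) = here refl
    f {x} (inj₂ a) = there (∈-filter⁺ (T? ∘ adj G v) (∈-allFin x) (Equivalence.from T-≡ a))

  deg<∣nbhd∣ : ∀ v → suc (deg G v) ℕ.≤ ∣ nbhd v ∣
  deg<∣nbhd∣ v = unique⇒length≤∣∣ {xs = v ∷ filterᵇ (adj G v) (allFin n)}
    (All.tabulate (λ { x∈ refl → irr (Equivalence.to T-≡ (proj₂ (∈-filter⁻ (T? ∘ adj G v) {xs = allFin n} x∈))) })
      ∷ Unique.filter⁺ (T? ∘ adj G v) (Unique.allFin⁺ n))
    λ { (here refl) → self∈nbhd v
      ; (there x∈) → adj⇒∈nbhd (Equivalence.to T-≡ (proj₂ (∈-filter⁻ (T? ∘ adj G v) {xs = allFin n} x∈))) }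
    where
    irr : ¬ adj G v v ≡ true
    irr a with trans (sym a) (adj-irrefl G v)
    ... | ()

  Clique⊆nbhd : ∀ {S v} → Clique G S → v ∈ S → S ⊆ nbhd v
  Clique⊆nbhd {S} {v} c v∈ {x} x∈ with v ≟ x
  ... | yes refl = self∈nbhd v
  ... | no v≢x = adj⇒∈nbhd (c v∈ x∈ v≢x)

-- Pigeonhole: otherwise `ys` would enumerate `W`. It serves to pick vertices distinct from those
-- already named.
outsider : {W : Subset n} (ys : List (Fin n)) → length ys ℕ.< ∣ W ∣ → ∃[ x ] x ∈ W × x ∉ˡ ys
outsider {n} {W} ys ys<W with Fin.any? (λ x → (x ∈? W) ×-dec ¬? (DecMembership._∈?_ _≟_ x ys))
... | yes p = p
... | no ¬p = contradiction (∣∣≤length W⊆ys) (ℕ.<⇒≱ ys<W)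
  where
  W⊆ys : ∀ {x} → x ∈ W → x ∈ˡ ys
  W⊆ys {x} x∈W with DecMembership._∈?_ _≟_ x ys
  ... | yes x∈ys = x∈ys
  ... | no x∉ys = contradiction (x , x∈W , x∉ys) ¬p

-- Copies of K_r under the degree and clique bounds.

module Bounded (G : Graph n) (r : ℕ)
    (Δ≤ : ∀ v → deg G v ℕ.≤ suc r)
    (ω≤ : ∀ S → IsClique G S → ∣ S ∣ ℕ.≤ r) where

  N : Fin n → Subset n
  N = nbhd G

  ∣N∣≤ : ∀ v → ∣ N v ∣ ℕ.≤ 2 ℕ.+ r
  ∣N∣≤ v = ℕ.≤-trans (∣nbhd∣≤ G v) (s≤s (Δ≤ v))

  Kᵣ : Subset n → Set
  Kᵣ = IsK G r

  d : Fin n → ℕ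
  d v = length (filter (v ∈?_) (cliques G r))

  Kᵣ⊆N : ∀ {B v} → Kᵣ B → v ∈ B → B ⊆ N v
  Kᵣ⊆N (_ , c) = Clique⊆nbhd G c

  ≁⇒∉ : ∀ {B x y} → Kᵣ B → x ∈ B → x ≢ y → adj G x y ≡ false → y ∉ B
  ≁⇒∉ (_ , c) x∈B x≢y x≁y y∈B with () ← trans (sym x≁y) (c x∈B y∈B x≢y)

  d≤length : ∀ {v} (Bs : List (Subset n)) → (∀ {B} → Kᵣ B → v ∈ B → B ∈ˡ Bs) → d v ℕ.≤ length Bs
  d≤length {v} Bs h = unique-⊆⇒length≤ (Unique.filter⁺ (v ∈?_) (unique-cliques G r)) λ B∈ →
    let B∈K , v∈B = ∈-filter⁻ (v ∈?_) {xs = cliques G r} B∈ in h (∈-cliques⁻ G B∈K) v∈B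

  -- A set with more than r vertices has a non-adjacent pair s, t,
  -- and a clique inside it misses s or t.
  cover : ∀ m (W : Subset n) → ∣ W ∣ ℕ.≤ m ℕ.+ r →
          ∃[ Bs ] length Bs ℕ.≤ 2 ^ m × (∀ {B} → Kᵣ B → B ⊆ W → B ∈ˡ Bs)
  cover zero W W≤ = (W ∷ []) , ℕ.≤-refl , λ (B≡r , _) B⊆W →
    here (⊆∧∣∣≥⇒≡ B⊆W (subst (∣ W ∣ ℕ.≤_) (sym B≡r) W≤))
  cover (suc m) W W≤ with ∣ W ∣ ℕ.≤? m ℕ.+ r
  ... | yes W≤′ = let Bs , l , c = cover m W W≤′ in Bs , ℕ.≤-trans l (ℕ.m≤m+n _ _) , c
  ... | no W≰ with nonadjacentPair G {W} (λ c → W≰ (ℕ.≤-trans (ω≤ W (Clique⇒IsClique G c)) (ℕ.m≤n+m r m)))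
  ... | s , t , s∈W , t∈W , s≢t , s≁t =
    let Bs , l , c = cover m (W ∖ s) (smaller s∈W)
        Bs′ , l′ , c′ = cover m (W ∖ t) (smaller t∈W)
    in Bs ++ Bs′ ,
       (begin
         length (Bs ++ Bs′)          ≡⟨ List.length-++ Bs ⟩
         length Bs ℕ.+ length Bs′    ≤⟨ ℕ.+-mono-≤ l l′ ⟩
         2 ^ m ℕ.+ 2 ^ m             ≡⟨ cong (2 ^ m ℕ.+_) (ℕ.+-identityʳ (2 ^ m)) ⟨
         2 ^ suc m                   ∎) ,
       λ {B} K B⊆W → split K B⊆W (s ∈? B) c c′
    where
    open ℕ.≤-Reasoning
    smaller : ∀ {x} → x ∈ W → ∣ W ∖ x ∣ ℕ.≤ m ℕ.+ r
    smaller x∈W = ℕ.≤-pred (ℕ.≤-trans (x∈p⇒∣p-x∣<∣p∣ x∈W) W≤)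
    without : ∀ {B x} → B ⊆ W → x ∉ B → B ⊆ W ∖ x
    without B⊆W x∉B y∈B = x∈p∧x≢y⇒x∈p-y (B⊆W y∈B) λ { refl → x∉B y∈B }
    split : ∀ {B Bs Bs′} → Kᵣ B → B ⊆ W → Dec (s ∈ B) →
            (∀ {B} → Kᵣ B → B ⊆ W ∖ s → B ∈ˡ Bs) → (∀ {B} → Kᵣ B → B ⊆ W ∖ t → B ∈ˡ Bs′) →
            B ∈ˡ Bs ++ Bs′
    split {Bs = Bs} K B⊆W (yes s∈B) c c′ = ∈-++⁺ʳ Bs (c′ K (without B⊆W (≁⇒∉ K s∈B s≢t s≁t)))
    split K B⊆W (no s∉B) c c′ = ∈-++⁺ˡ (c K (without B⊆W s∉B))

  -- Confining all copies through `v` to a small set bounds `d v`. The excess `m` over r is 2 for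
  -- `N v`, and drops by one for each vertex of `N v` that these copies are known to avoid.
  d≤2^ : ∀ {v} m (W : Subset n) → ∣ W ∣ ℕ.≤ m ℕ.+ r → (∀ {B} → Kᵣ B → v ∈ B → B ⊆ W) → d v ℕ.≤ 2 ^ m
  d≤2^ m W W≤ h = let Bs , l , c = cover m W W≤ in
    ℕ.≤-trans (d≤length Bs λ K v∈B → c K (h K v∈B)) l

  d≤4 : ∀ v → d v ℕ.≤ 4
  d≤4 v = d≤2^ 2 (N v) (∣N∣≤ v) Kᵣ⊆N

  -- The r vertices of `B` already lie in `N v`, which has at most r + 2 vertices, so only two
  -- places remain outside `B`. Most structural arguments below use the degree bound in this form.
  three-outside : ∀ {B v a b c} → Kᵣ B → v ∈ B → a ∉ B → b ∉ B → c ∉ B →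
                  a ≢ b → a ≢ c → b ≢ c → a ∈ N v → b ∈ N v → c ∈ N v → ⊥
  three-outside {B} {v} {a} {b} {c} K@(B≡r , _) v∈B a∉ b∉ c∉ a≢b a≢c b≢c a∈ b∈ c∈ =
    ℕ.<-irrefl refl (begin-strict
      2 ℕ.+ r                        <⟨ ℕ.n<1+n (2 ℕ.+ r) ⟩
      3 ℕ.+ r                        ≡⟨ cong (3 ℕ.+_) (trans (length-members B) B≡r) ⟨
      length (a ∷ b ∷ c ∷ members B) ≤⟨ unique⇒length≤∣∣ unique inside ⟩
      ∣ N v ∣                        ≤⟨ ∣N∣≤ v ⟩
      2 ℕ.+ r                        ∎)
    where
    open ℕ.≤-Reasoning
    fresh : ∀ {x} → x ∉ B → All (x ≢_) (members B)
    fresh x∉B = All.tabulate λ { y∈ refl → x∉B (∈-members⁻ y∈) }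
    unique : Unique (a ∷ b ∷ c ∷ members B)
    unique = (a≢b ∷ a≢c ∷ fresh a∉) ∷ (b≢c ∷ fresh b∉) ∷ fresh c∉ ∷ unique-members B
    inside : ∀ {x} → x ∈ˡ a ∷ b ∷ c ∷ members B → x ∈ N v
    inside (here refl) = a∈
    inside (there (here refl)) = b∈
    inside (there (there (here refl))) = c∈
    inside (there (there (there x∈))) = Kᵣ⊆N K v∈B (∈-members⁻ x∈)

  -- Otherwise adding `p` to `B` would give a clique on r + 1 vertices.
  nonneighbour : ∀ {B p} → Kᵣ B → p ∉ B → ∃[ y ] y ∈ B × adj G p y ≡ false
  nonneighbour {B} {p} (B≡r , c) p∉B with Fin.any? (λ y → (y ∈? B) ×-dec (adj G p y Bool.≟ false))
  ... | yes y = y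
  ... | no ¬y = ⊥-elim (ℕ.<-irrefl refl (begin-strict
      r                         <⟨ ℕ.n<1+n r ⟩
      suc r                     ≡⟨ cong suc (trans (length-members B) B≡r) ⟨
      length (p ∷ members B)    ≤⟨ unique⇒length≤∣∣ unique inside ⟩
      ∣ B ∪ ⁅ p ⁆ ∣             ≤⟨ ω≤ (B ∪ ⁅ p ⁆) (Clique⇒IsClique G clique) ⟩
      r                         ∎))
    where
    open ℕ.≤-Reasoning
    unique : Unique (p ∷ members B)
    unique = All.tabulate (λ { y∈ refl → p∉B (∈-members⁻ y∈) }) ∷ unique-members B
    inside : ∀ {x} → x ∈ˡ p ∷ members B → x ∈ B ∪ ⁅ p ⁆
    inside (here refl) = q⊆p∪q B _ (x∈⁅x⁆ p)
    inside (there x∈) = p⊆p∪q _ (∈-members⁻ x∈)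
    p∼ : ∀ {y} → y ∈ B → adj G p y ≡ true
    p∼ {y} y∈B with adj G p y in e
    ... | true = refl
    ... | false = ⊥-elim (¬y (y , y∈B , e))
    clique : Clique G (B ∪ ⁅ p ⁆)
    clique {i} {j} i∈ j∈ i≢j with x∈p∪q⁻ B ⁅ p ⁆ i∈ | x∈p∪q⁻ B ⁅ p ⁆ j∈
    ... | inj₁ i∈B | inj₁ j∈B = c i∈B j∈B i≢j
    ... | inj₁ i∈B | inj₂ j∈p rewrite x∈⁅y⁆⇒x≡y p j∈p = trans (adj-sym G i p) (p∼ i∈B)
    ... | inj₂ i∈p | inj₁ j∈B rewrite x∈⁅y⁆⇒x≡y p i∈p = p∼ j∈B
    ... | inj₂ i∈p | inj₂ j∈p =
      contradiction (trans (x∈⁅y⁆⇒x≡y p i∈p) (sym (x∈⁅y⁆⇒x≡y p j∈p))) i≢j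

  -- The structure around a vertex in at least three copies of K_r.

  module Heavy (4≤r : 4 ℕ.≤ r) {A : Subset n} {v : Fin n} (KA : Kᵣ A) (v∈A : v ∈ A) (heavy : ¬ d v ℕ.≤ 2) where

    record Outer (p q : Fin n) : Set where
      field
        p∈N : p ∈ N v
        q∈N : q ∈ N v
        p∉A : p ∉ A
        q∉A : q ∉ A
        p≢q : p ≢ q
        only : ∀ {s} → s ∈ N v → s ∉ A → s ≡ p ⊎ s ≡ q
    open Outer

    -- The two outer vertices play symmetric roles; arguments given for `p` are transferred to `q`
    -- by this exchange.
    flip : ∀ {p q} → Outer p q → Outer q p
    flip o = record { p∈N = q∈N o ; q∈N = p∈N o ; p∉A = q∉A o ; q∉A = p∉A o
                    ; p≢q = p≢q o ∘ sym ; only = λ s∈ s∉ → swap (only o s∈ s∉) }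

    -- If `N v` had at most r + 1 vertices, `d≤2^` would give `d v ≤ 2`. Hence `N v` has at least
    -- two vertices outside `A`, and `three-outside` rules out a third.
    outer : ∃[ p ] ∃[ q ] Outer p q
    outer =
      let p , p∈ , p∉ = outsider (members A) (ℕ.≤-trans (s≤s (ℕ.≤-trans A≤ (ℕ.n≤1+n r))) N≥)
          q , q∈ , q∉ = outsider (p ∷ members A) (ℕ.≤-trans (s≤s (s≤s A≤)) N≥)
      in p , q , record
        { p∈N = p∈ ; q∈N = q∈ ; p∉A = p∉ ∘ ∈-members⁺ ; q∉A = q∉ ∘ there ∘ ∈-members⁺
        ; p≢q = λ p≡q → q∉ (here (sym p≡q))
        ; only = only′ p∈ q∈ (p∉ ∘ ∈-members⁺) (q∉ ∘ there ∘ ∈-members⁺) (λ p≡q → q∉ (here (sym p≡q))) }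
      where
      A≤ : length (members A) ℕ.≤ r
      A≤ = ℕ.≤-reflexive (trans (length-members A) (proj₁ KA))
      N≥ : 2 ℕ.+ r ℕ.≤ ∣ N v ∣
      N≥ = ℕ.≰⇒> λ N≤ → heavy (d≤2^ 1 (N v) N≤ Kᵣ⊆N)
      only′ : ∀ {p q} → p ∈ N v → q ∈ N v → p ∉ A → q ∉ A → p ≢ q →
              ∀ {s} → s ∈ N v → s ∉ A → s ≡ p ⊎ s ≡ q
      only′ {p} {q} p∈ q∈ p∉ q∉ p≢q {s} s∈ s∉ with s ≟ p | s ≟ q
      ... | yes s≡p | _ = inj₁ s≡p
      ... | no _ | yes s≡q = inj₂ s≡q
      ... | no s≢p | no s≢q = ⊥-elim (three-outside KA v∈A s∉ p∉ q∉ s≢p s≢q p≢q s∈ p∈ q∈)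

    ≢outer : ∀ {p x} → p ∉ A → x ∈ A → x ≢ p
    ≢outer p∉A x∈A refl = p∉A x∈A

    A⊆N : A ⊆ N v
    A⊆N = Kᵣ⊆N KA v∈A

    -- Otherwise every clique through v avoids p: a clique through v and p
    -- would miss three vertices of N v.
    no-three-nonneighbours : ∀ {p q x y z} → Outer p q → x ∈ A → y ∈ A → z ∈ A →
      x ≢ y → x ≢ z → y ≢ z → adj G p x ≡ false → adj G p y ≡ false →
      adj G p z ≡ false ⊎ adj G q z ≡ false → ⊥
    no-three-nonneighbours {p} {q} {x} {y} {z} o x∈ y∈ z∈ x≢y x≢z y≢z p≁x p≁y pq≁z =
      heavy (d≤2^ 1 (N v ∖ p) (ℕ.≤-pred (ℕ.≤-trans (x∈p⇒∣p-x∣<∣p∣ (p∈N o)) (∣N∣≤ v)))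
        λ K v∈B y∈B → x∈p∧x≢y⇒x∈p-y (Kᵣ⊆N K v∈B y∈B) λ { refl → avoids K v∈B y∈B pq≁z })
      where
      avoids : ∀ {B} → Kᵣ B → v ∈ B → p ∈ B → adj G p z ≡ false ⊎ adj G q z ≡ false → ⊥
      avoids {B} K v∈B p∈B = λ where
          (inj₁ p≁z) → missing z∈ p≁z x≢z y≢z
          (inj₂ q≁z) → missing-q q≁z (z ∈? B)
        where
        ∉B : ∀ {w} → w ∈ A → adj G p w ≡ false → w ∉ B
        ∉B w∈ = ≁⇒∉ K p∈B (≢outer (p∉A o) w∈ ∘ sym)
        outside : ∀ {w} → w ∉ B → x ≢ w → y ≢ w → w ∈ N v → ⊥
        outside w∉B x≢w y≢w w∈N = three-outside K v∈B (∉B x∈ p≁x) (∉B y∈ p≁y) w∉B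
          x≢y x≢w y≢w (A⊆N x∈) (A⊆N y∈) w∈N
        missing : ∀ {w} → w ∈ A → adj G p w ≡ false → x ≢ w → y ≢ w → ⊥
        missing w∈ p≁w x≢w y≢w = outside (∉B w∈ p≁w) x≢w y≢w (A⊆N w∈)
        missing-q : adj G q z ≡ false → Dec (z ∈ B) → ⊥
        missing-q q≁z (no z∉B) = outside z∉B x≢z y≢z (A⊆N z∈)
        -- When `z` lies in `B`, its non-neighbour `q` cannot, and `q` becomes the third vertex of
        -- `N v` missing from `B`.
        missing-q q≁z (yes z∈B) = outside
          (≁⇒∉ K z∈B (≢outer (q∉A o) z∈) (trans (adj-sym G z q) q≁z))
          (≢outer (q∉A o) x∈) (≢outer (q∉A o) y∈) (q∈N o)

    -- The configuration to be refuted for `meets⇒∋v`: a copy that meets `A` but avoids `v`.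
    module Stray {D : Subset n} {x : Fin n} (KD : Kᵣ D) (x∈D : x ∈ D) (x∈A : x ∈ A) (v∉D : v ∉ D) where

      -- Since D ∪ {v} is not a clique, D leaves N v.
      stray : ∃[ s ] s ∈ D × adj G v s ≡ false
      stray = nonneighbour KD v∉D

      s : Fin n
      s = proj₁ stray

      s∈D : s ∈ D
      s∈D = proj₁ (proj₂ stray)

      s∉N : s ∉ N v
      s∉N s∈N with ∈nbhd⁻ G s∈N
      ... | inj₁ v≡s = v∉D (subst (_∈ D) (sym v≡s) s∈D)
      ... | inj₂ v∼s with () ← trans (sym v∼s) (proj₂ (proj₂ stray))

      s∉A : s ∉ A
      s∉A = s∉N ∘ A⊆N

      ∉N⇒≢ : ∀ {t p} → t ∉ N v → p ∈ N v → t ≢ p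
      ∉N⇒≢ t∉N p∈N refl = t∉N p∈N

      -- The vertices `s` and `t` of `D` fill the two places of `N w` outside `A`, so `p` would be a
      -- third.
      D-outside : ∀ {w t p} → w ∈ D → w ∈ A → t ∈ D → t ∉ A → t ≢ s → p ∉ A → p ≢ s → p ≢ t →
                  adj G p w ≡ false
      D-outside {w} {t} {p} w∈D w∈A t∈D t∉A t≢s p∉A p≢s p≢t with adj G p w in e
      ... | false = refl
      ... | true = ⊥-elim (three-outside KA w∈A t∉A s∉A p∉A t≢s (p≢t ∘ sym) (p≢s ∘ sym)
                     (Kᵣ⊆N KD w∈D t∈D) (Kᵣ⊆N KD w∈D s∈D) (adj⇒∈nbhd G (trans (adj-sym G w p) e)))

      -- Since `s` lies in `N w` outside `A` and differs from both outer vertices, there is room in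
      -- `N w` for at most one of `p` and `q`.
      not-full : ∀ {p q w} → Outer p q → w ∈ D → w ∈ A → adj G p w ≡ false ⊎ adj G q w ≡ false
      not-full {p} {q} {w} o w∈D w∈A with adj G p w in e | adj G q w in e′
      ... | false | _ = inj₁ refl
      ... | true | false = inj₂ refl
      ... | true | true = ⊥-elim (three-outside KA w∈A s∉A (p∉A o) (q∉A o)
              (∉N⇒≢ s∉N (p∈N o)) (∉N⇒≢ s∉N (q∈N o)) (p≢q o)
              (Kᵣ⊆N KD w∈D s∈D) (neighbour p e) (neighbour q e′))
        where
        neighbour : ∀ p → adj G p w ≡ true → p ∈ N w
        neighbour p e = adj⇒∈nbhd G (trans (adj-sym G w p) e)

      -- This is where r ≥ 4 enters the structural argument: `D` always has a vertex besides three
      -- given ones.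
      many : (ys : List (Fin n)) → length ys ℕ.< 4 → ∃[ y ] y ∈ D × y ∉ˡ ys
      many ys l = outsider ys (ℕ.≤-trans l (subst (4 ℕ.≤_) (sym (proj₁ KD)) 4≤r))

      -- Besides `x`, the copy `D` has three further vertices, all in `N x`; at most two of them can
      -- lie outside `A`.
      another : ∃[ z ] z ∈ D × z ∈ A × x ≢ z
      another with many (x ∷ []) (s≤s (s≤s z≤n))
      ... | a , a∈D , a∉ with many (x ∷ a ∷ []) (s≤s (s≤s (s≤s z≤n)))
      ... | b , b∈D , b∉ with many (x ∷ a ∷ b ∷ []) (s≤s (s≤s (s≤s (s≤s z≤n))))
      ... | c , c∈D , c∉ with a ∈? A | b ∈? A | c ∈? A
      ... | yes a∈A | _ | _ = a , a∈D , a∈A , λ { refl → a∉ (here refl) }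
      ... | no _ | yes b∈A | _ = b , b∈D , b∈A , λ { refl → b∉ (here refl) }
      ... | no _ | no _ | yes c∈A = c , c∈D , c∈A , λ { refl → c∉ (here refl) }
      ... | no a∉A | no b∉A | no c∉A = ⊥-elim (three-outside KA x∈A a∉A b∉A c∉A
              (λ { refl → b∉ (there (here refl)) }) (λ { refl → c∉ (there (here refl)) })
              (λ { refl → c∉ (there (there (here refl))) })
              (Kᵣ⊆N KD x∈D a∈D) (Kᵣ⊆N KD x∈D b∈D) (Kᵣ⊆N KD x∈D c∈D))

      module _ {z : Fin n} (z∈D : z ∈ D) (z∈A : z ∈ A) (x≢z : x ≢ z) where

        -- So `D` meets `A` in `x` and `z` only. By `not-full`, each of `x`, `z`, `w` would be
        -- non-adjacent to `p` or `q`; two of them share such an outer vertex, and the third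
        -- completes the configuration excluded by `no-three-nonneighbours`.
        D∩A : ∀ {p q w} → Outer p q → w ∈ D → x ≢ w → z ≢ w → w ∉ A
        D∩A {p} {q} {w} o w∈D x≢w z≢w w∈A =
          pigeonhole (not-full o x∈D x∈A) (not-full o z∈D z∈A) (not-full o w∈D w∈A)
          where
          pigeonhole : adj G p x ≡ false ⊎ adj G q x ≡ false →
                       adj G p z ≡ false ⊎ adj G q z ≡ false →
                       adj G p w ≡ false ⊎ adj G q w ≡ false → ⊥
          pigeonhole (inj₁ a) (inj₁ b) c =
            no-three-nonneighbours o x∈A z∈A w∈A x≢z x≢w z≢w a b c
          pigeonhole (inj₁ a) b@(inj₂ _) (inj₁ c) =
            no-three-nonneighbours o x∈A w∈A z∈A x≢w x≢z (z≢w ∘ sym) a c b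
          pigeonhole a@(inj₁ _) (inj₂ b) (inj₂ c) =
            no-three-nonneighbours (flip o) z∈A w∈A x∈A z≢w (x≢z ∘ sym) (x≢w ∘ sym) b c (swap a)
          pigeonhole a@(inj₂ _) (inj₁ b) (inj₁ c) =
            no-three-nonneighbours o z∈A w∈A x∈A z≢w (x≢z ∘ sym) (x≢w ∘ sym) b c a
          pigeonhole (inj₂ a) b@(inj₁ _) (inj₂ c) =
            no-three-nonneighbours (flip o) x∈A w∈A z∈A x≢w x≢z (z≢w ∘ sym) a c (swap b)
          pigeonhole (inj₂ a) (inj₂ b) c =
            no-three-nonneighbours (flip o) x∈A z∈A w∈A x≢z x≢w z≢w a b (swap c)

        -- If `p` were in `D`, it would be adjacent to `x` and `z`, so `not-full` would make both
        -- non-adjacent to `q`. A vertex `y` of `A` non-adjacent to `p` is then a third vertex, and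
        -- `no-three-nonneighbours` applies with `p` and `q` exchanged.
        p∉D : ∀ {p q} → Outer p q → p ∉ D
        p∉D {p} {q} o p∈D with nonneighbour KA (p∉A o)
        ... | y , y∈A , p≁y =
          no-three-nonneighbours (flip o) x∈A z∈A y∈A x≢z
            (λ { refl → p≁ x∈D x∈A p≁y }) (λ { refl → p≁ z∈D z∈A p≁y })
            (q≁ x∈D x∈A) (q≁ z∈D z∈A) (inj₂ p≁y)
          where
          p≁ : ∀ {w} → w ∈ D → w ∈ A → ¬ adj G p w ≡ false
          p≁ w∈D w∈A p≁w = ≁⇒∉ KD p∈D (≢outer (p∉A o) w∈A ∘ sym) p≁w w∈D
          q≁ : ∀ {w} → w ∈ D → w ∈ A → adj G q w ≡ false
          q≁ w∈D w∈A with not-full o w∈D w∈A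
          ... | inj₁ p≁w = ⊥-elim (p≁ w∈D w∈A p≁w)
          ... | inj₂ q≁w = q≁w

        -- D now has a second vertex t outside N v, which uses up the degrees of x and z,
        -- so both are non-adjacent to p and q, and A and N v ∖ {x, z} are the only
        -- cliques through v.
        impossible : ∀ {p q} → Outer p q → ⊥
        impossible {p} {q} o with many (x ∷ z ∷ s ∷ []) (s≤s (s≤s (s≤s (s≤s z≤n))))
        ... | t , t∈D , t∉ = heavy (d≤length (A ∷ (N v ∖ x ∖ z) ∷ []) two)
          where
          t∉A : t ∉ A
          t∉A = D∩A o t∈D (λ { refl → t∉ (here refl) }) (λ { refl → t∉ (there (here refl)) })
          isolated : ∀ {w p q} → w ∈ D → w ∈ A → Outer p q → adj G p w ≡ false
          isolated w∈D w∈A o = D-outside w∈D w∈A t∈D t∉A (λ t≡s → t∉ (there (there (here t≡s))))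
            (p∉A o) (λ p≡s → p∉D o (subst (_∈ D) (sym p≡s) s∈D)) (λ { refl → p∉D o t∈D })
          ⊆A : ∀ {B w} → Kᵣ B → v ∈ B → w ∈ B → w ∈ D → w ∈ A → B ⊆ A
          ⊆A {B} {w} K v∈B w∈B w∈D w∈A {u} u∈B with u ∈? A
          ... | yes u∈A = u∈A
          ... | no u∉A with only o (Kᵣ⊆N K v∈B u∈B) u∉A
          ... | inj₁ refl = ⊥-elim (≁⇒∉ K u∈B (≢outer u∉A w∈A ∘ sym) (isolated w∈D w∈A o) w∈B)
          ... | inj₂ refl = ⊥-elim (≁⇒∉ K u∈B (≢outer u∉A w∈A ∘ sym) (isolated w∈D w∈A (flip o)) w∈B)
          ≡A : ∀ {B} → Kᵣ B → B ⊆ A → B ≡ A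
          ≡A K B⊆A = ⊆∧∣∣≥⇒≡ B⊆A (ℕ.≤-reflexive (trans (proj₁ KA) (sym (proj₁ K))))
          small : ∣ N v ∖ x ∖ z ∣ ℕ.≤ r
          small = ℕ.≤-pred (ℕ.≤-trans (x∈p⇒∣p-x∣<∣p∣ (x∈p∧x≢y⇒x∈p-y (A⊆N z∈A) (x≢z ∘ sym)))
                    (ℕ.≤-pred (ℕ.≤-trans (x∈p⇒∣p-x∣<∣p∣ (A⊆N x∈A)) (∣N∣≤ v))))
          two : ∀ {B} → Kᵣ B → v ∈ B → B ∈ˡ A ∷ (N v ∖ x ∖ z) ∷ []
          two {B} K v∈B with x ∈? B | z ∈? B
          ... | yes x∈B | _ = here (≡A K (⊆A K v∈B x∈B x∈D x∈A))
          ... | no _ | yes z∈B = here (≡A K (⊆A K v∈B z∈B z∈D z∈A))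
          ... | no x∉B | no z∉B = there (here (⊆∧∣∣≥⇒≡
            (λ u∈B → x∈p∧x≢y⇒x∈p-y (x∈p∧x≢y⇒x∈p-y (Kᵣ⊆N K v∈B u∈B) λ { refl → x∉B u∈B }) λ { refl → z∉B u∈B })
            (subst (∣ N v ∖ x ∖ z ∣ ℕ.≤_) (sym (proj₁ K)) small)))

    -- Consequently all copies through any vertex of `A` lie inside `N v`, so their number can be
    -- bounded there.
    meets⇒∋v : ∀ {D x} → Kᵣ D → x ∈ D → x ∈ A → v ∈ D
    meets⇒∋v {D} {x} KD x∈D x∈A with v ∈? D
    ... | yes v∈D = v∈D
    ... | no v∉D = let z , z∈D , z∈A , x≢z = another
                       _ , _ , o = outer
                   in ⊥-elim (impossible z∈D z∈A x≢z o)
      where open Stray KD x∈D x∈A v∉D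

    light : ∃[ x ] ∃[ y ] x ∈ A × y ∈ A × (x ≡ y × d x ℕ.≤ 1 ⊎ x ≢ y × d x ℕ.≤ 2 × d y ℕ.≤ 2)
    light with outer
    ... | p , q , o with nonneighbour KA (p∉A o) | nonneighbour KA (q∉A o)
    ... | x , x∈A , p≁x | y , y∈A , q≁y = x , y , x∈A , y∈A , cases (x ≟ y)
      where
      avoid : ∀ {D p x} → p ∉ A → x ∈ A → adj G p x ≡ false → Kᵣ D → x ∈ D → D ⊆ N v ∖ p
      -- Containment in `N v` comes from `meets⇒∋v`; `p` drops out because it is non-adjacent to the
      -- vertex `x` of the copy.
      avoid {p = p} {x} p∉A x∈A p≁x K x∈D u∈D = x∈p∧x≢y⇒x∈p-y (Kᵣ⊆N K (meets⇒∋v K x∈D x∈A) u∈D)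
        λ { refl → ≁⇒∉ K u∈D (≢outer p∉A x∈A ∘ sym) p≁x x∈D }
      ∣N-∣≤ : ∀ {p} → p ∈ N v → ∣ N v ∖ p ∣ ℕ.≤ 1 ℕ.+ r
      ∣N-∣≤ p∈N = ℕ.≤-pred (ℕ.≤-trans (x∈p⇒∣p-x∣<∣p∣ p∈N) (∣N∣≤ v))
      cases : Dec (x ≡ y) → x ≡ y × d x ℕ.≤ 1 ⊎ x ≢ y × d x ℕ.≤ 2 × d y ℕ.≤ 2
      cases (yes refl) = inj₁ (refl , d≤2^ 0 (N v ∖ p ∖ q)
        (ℕ.≤-pred (ℕ.≤-trans (x∈p⇒∣p-x∣<∣p∣ (x∈p∧x≢y⇒x∈p-y (q∈N o) (p≢q o ∘ sym))) (∣N-∣≤ (p∈N o))))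
        λ K x∈D u∈D → x∈p∧x≢y⇒x∈p-y (avoid (p∉A o) x∈A p≁x K x∈D u∈D)
          λ { refl → ≁⇒∉ K u∈D (≢outer (q∉A o) x∈A ∘ sym) q≁y x∈D })
      cases (no x≢y) = inj₂ (x≢y ,
        d≤2^ 1 (N v ∖ p) (∣N-∣≤ (p∈N o)) (avoid (p∉A o) x∈A p≁x) ,
        d≤2^ 1 (N v ∖ q) (∣N-∣≤ (q∈N o)) (avoid (q∉A o) y∈A q≁y))

  -- A vertex of `A` in more than two copies is handled by `Heavy.light`; without one, any two
  -- vertices of `A` serve. In the first alternative `y` merely repeats `x`, so that one existential
  -- form covers both outcomes.
  light-vertices : 4 ℕ.≤ r → ∀ {A} → Kᵣ A →
    ∃[ x ] ∃[ y ] x ∈ A × y ∈ A × (x ≡ y × d x ℕ.≤ 1 ⊎ x ≢ y × d x ℕ.≤ 2 × d y ℕ.≤ 2)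
  light-vertices 4≤r {A} K with Fin.any? (λ v → (v ∈? A) ×-dec ¬? (d v ℕ.≤? 2))
  ... | yes (v , v∈A , heavy) = Heavy.light 4≤r K v∈A heavy
  ... | no ¬heavy with outsider {W = A} [] (pos (s≤s z≤n))
    where pos : ∀ {m} → m ℕ.≤ 4 → m ℕ.≤ ∣ A ∣
          pos l = ℕ.≤-trans l (subst (4 ℕ.≤_) (sym (proj₁ K)) 4≤r)
  ... | x , x∈A , _ with outsider {W = A} (x ∷ []) (ℕ.≤-trans (s≤s (s≤s z≤n)) (subst (4 ℕ.≤_) (sym (proj₁ K)) 4≤r))
  ... | y , y∈A , y∉ = x , y , x∈A , y∈A , inj₂ ((λ { refl → y∉ (here refl) }) , ≤2 x∈A , ≤2 y∈A)
    where
    ≤2 : ∀ {v} → v ∈ A → d v ℕ.≤ 2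
    ≤2 {v} v∈A with d v ℕ.≤? 2
    ... | yes l = l
    ... | no g = ⊥-elim (¬heavy (v , v∈A , g))

-- Weights, double counting and the upper bound.

length*≤sum : (c : ℕ) (f : X → ℕ) {xs : List X} → (∀ {x} → x ∈ˡ xs → c ℕ.≤ f x) →
              length xs ℕ.* c ℕ.≤ sum (map f xs)
length*≤sum c f {[]} h = z≤n
length*≤sum c f {x ∷ xs} h = ℕ.+-mono-≤ (h (here refl)) (length*≤sum c f (h ∘ there))

sum≤length* : (c : ℕ) (f : X → ℕ) (xs : List X) → (∀ x → f x ℕ.≤ c) →
              sum (map f xs) ℕ.≤ length xs ℕ.* c
sum≤length* c f [] h = z≤n
sum≤length* c f (x ∷ xs) h = ℕ.+-mono-≤ (h x) (sum≤length* c f xs h)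

sum-map-+ : (f g : X → ℕ) (xs : List X) →
            sum (map (λ x → f x ℕ.+ g x) xs) ≡ sum (map f xs) ℕ.+ sum (map g xs)
sum-map-+ f g [] = refl
sum-map-+ f g (x ∷ xs) = trans (cong (f x ℕ.+ g x ℕ.+_) (sum-map-+ f g xs))
  (interchange (f x) (g x) (sum (map f xs)) (sum (map g xs)))
  where
  interchange : ∀ a b c d → a ℕ.+ b ℕ.+ (c ℕ.+ d) ≡ a ℕ.+ c ℕ.+ (b ℕ.+ d)
  interchange = solve-∀

-- Both sides sum `w v` over the incidences of `v` with a set of the list. In the induction, the
-- members of the head are spread over all vertices, with weight zero off the head.
double-counting : (w : Fin n → ℕ) (Ss : List (Subset n)) →
  sum (map (λ S → sum (map w (members S))) Ss) ℕ.≤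
  sum (map (λ v → length (filter (v ∈?_) Ss) ℕ.* w v) (allFin n))
double-counting w [] = z≤n
double-counting {n} w (S ∷ Ss) = begin
  sum (map w (members S)) ℕ.+ sum (map (λ S → sum (map w (members S))) Ss)
    ≤⟨ ℕ.+-mono-≤ first (double-counting w Ss) ⟩
  sum (map restricted (allFin n)) ℕ.+ sum (map (λ v → length (filter (v ∈?_) Ss) ℕ.* w v) (allFin n))
    ≡⟨ sum-map-+ restricted _ (allFin n) ⟨
  sum (map (λ v → restricted v ℕ.+ length (filter (v ∈?_) Ss) ℕ.* w v) (allFin n))
    ≡⟨ cong sum (List.map-cong merge (allFin n)) ⟩
  sum (map (λ v → length (filter (v ∈?_) (S ∷ Ss)) ℕ.* w v) (allFin n)) ∎
  where
  open ℕ.≤-Reasoning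
  restricted : Fin n → ℕ
  restricted v = if does (v ∈? S) then w v else 0
  first : sum (map w (members S)) ℕ.≤ sum (map restricted (allFin n))
  first = subst (ℕ._≤ sum (map restricted (allFin n)))
    (cong sum (List.map-cong-local {xs = members S} (All.tabulate λ {v} v∈ →
      cong (if_then w v else 0) (dec-true (v ∈? S) (∈-members⁻ v∈)))))
    (unique-⊆⇒sum≤ restricted (unique-members S) λ _ → ∈-allFin _)
  merge : ∀ v → restricted v ℕ.+ length (filter (v ∈?_) Ss) ℕ.* w v ≡
                length (filter (v ∈?_) (S ∷ Ss)) ℕ.* w v
  merge v with does (v ∈? S)
  ... | true = refl
  ... | false = refl

-- The values satisfy d * weight d ≤ 4 for d ≤ 4, and in the extremal graph T_r(r+2) a
-- clique collects (r - 2) · 1 + 2 · 2 = r + 2.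
weight : ℕ → ℕ
weight 0 = 4
weight 1 = 4
weight 2 = 2
weight (suc (suc (suc _))) = 1

1≤weight : ∀ d → 1 ℕ.≤ weight d
1≤weight 0 = s≤s z≤n
1≤weight 1 = s≤s z≤n
1≤weight 2 = s≤s z≤n
1≤weight (suc (suc (suc _))) = s≤s z≤n

-- The light vertices come only with upper bounds on `d`, so `weight 0` is set to 4 to make the
-- estimate hold at 0 too.
4≤weight : ∀ {d} → d ℕ.≤ 1 → 4 ℕ.≤ weight d
4≤weight z≤n = ℕ.≤-refl
4≤weight (s≤s z≤n) = ℕ.≤-refl

2≤weight : ∀ {d} → d ℕ.≤ 2 → 2 ℕ.≤ weight d
2≤weight z≤n = s≤s (s≤s z≤n)
2≤weight (s≤s z≤n) = s≤s (s≤s z≤n)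
2≤weight (s≤s (s≤s z≤n)) = ℕ.≤-refl

d*weight≤4 : ∀ {d} → d ℕ.≤ 4 → d ℕ.* weight d ℕ.≤ 4
d*weight≤4 z≤n = z≤n
d*weight≤4 (s≤s z≤n) = ℕ.≤-refl
d*weight≤4 (s≤s (s≤s z≤n)) = ℕ.≤-refl
d*weight≤4 (s≤s (s≤s (s≤s z≤n))) = ℕ.n≤1+n 3
d*weight≤4 (s≤s (s≤s (s≤s (s≤s z≤n)))) = ℕ.≤-refl

-- Each vertex of `S` outside `ys` contributes at least 1. The term `length ys` stands on the right
-- to avoid truncated subtraction.
sum-members≥ : (w : Fin n → ℕ) → (∀ v → 1 ℕ.≤ w v) → (S : Subset n) (ys : List (Fin n)) →
  Unique ys → (∀ {y} → y ∈ˡ ys → y ∈ S) →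
  ∣ S ∣ ℕ.+ sum (map w ys) ℕ.≤ length ys ℕ.+ sum (map w (members S))
sum-members≥ {n} w 1≤w S ys u sub = begin
  ∣ S ∣ ℕ.+ sum (map w ys)                        ≤⟨ ℕ.+-monoˡ-≤ _ (∣∣≤length split) ⟩
  length (ys ++ rest) ℕ.+ sum (map w ys)          ≡⟨ cong (ℕ._+ sum (map w ys)) (List.length-++ ys) ⟩
  length ys ℕ.+ length rest ℕ.+ sum (map w ys)    ≤⟨ ℕ.+-monoˡ-≤ _ (ℕ.+-monoʳ-≤ (length ys) rest≤) ⟩
  length ys ℕ.+ sum (map w rest) ℕ.+ sum (map w ys) ≡⟨ rearrange (length ys) (sum (map w rest)) (sum (map w ys)) ⟩
  length ys ℕ.+ (sum (map w ys) ℕ.+ sum (map w rest)) ≡⟨ cong (length ys ℕ.+_) (trans (cong sum (List.map-++ w ys rest))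
                                                                             (sum-++ (map w ys) (map w rest))) ⟨
  length ys ℕ.+ sum (map w (ys ++ rest))          ≤⟨ ℕ.+-monoʳ-≤ (length ys) (unique-⊆⇒sum≤ w unique within) ⟩
  length ys ℕ.+ sum (map w (members S))           ∎
  where
  open ℕ.≤-Reasoning
  open DecMembership (_≟_ {n}) using () renaming (_∈?_ to _∈ˡ?_)
  new? = λ x → ¬? (x ∈ˡ? ys)
  rest = filter new? (members S)
  rearrange : ∀ a b c → a ℕ.+ b ℕ.+ c ≡ a ℕ.+ (c ℕ.+ b)
  rearrange = solve-∀
  rest≤ : length rest ℕ.≤ sum (map w rest)
  rest≤ = subst (ℕ._≤ sum (map w rest)) (ℕ.*-identityʳ (length rest)) (length*≤sum 1 w {rest} λ {x} _ → 1≤w x)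
  split : ∀ {x} → x ∈ S → x ∈ˡ ys ++ rest
  split {x} x∈S with x ∈ˡ? ys
  ... | yes x∈ys = ∈-++⁺ˡ x∈ys
  ... | no x∉ys = ∈-++⁺ʳ ys (∈-filter⁺ new? (∈-members⁺ x∈S) x∉ys)
  unique : Unique (ys ++ rest)
  unique = Unique.++⁺ u (Unique.filter⁺ new? (unique-members S))
    λ (x∈ys , x∈rest) → proj₂ (∈-filter⁻ new? {xs = members S} x∈rest) x∈ys
  within : ∀ {x} → x ∈ˡ ys ++ rest → x ∈ˡ members S
  within x∈ with ∈-++⁻ ys x∈
  ... | inj₁ x∈ys = ∈-members⁺ (sub x∈ys)
  ... | inj₂ x∈rest = proj₁ (∈-filter⁻ new? {xs = members S} x∈rest)

k*[r+2]≤n*4 : (G : Graph n) {r : ℕ} → 4 ℕ.≤ r → InClass (suc r) r G → k r G ℕ.* (2 ℕ.+ r) ℕ.≤ n ℕ.* 4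
k*[r+2]≤n*4 {n} G {r} 4≤r (Δ≤ , ω≤) = begin
  k r G ℕ.* (2 ℕ.+ r)                                           ≤⟨ length*≤sum (2 ℕ.+ r) _ (clique-weight ∘ ∈-cliques⁻ G) ⟩
  sum (map (λ A → sum (map w (members A))) (cliques G r))       ≤⟨ double-counting w (cliques G r) ⟩
  sum (map (λ v → d v ℕ.* w v) (allFin n))                      ≤⟨ sum≤length* 4 _ (allFin n) (λ v → d*weight≤4 (d≤4 v)) ⟩
  length (allFin n) ℕ.* 4                                       ≡⟨ cong (ℕ._* 4) (List.length-tabulate {n = n} id) ⟩
  n ℕ.* 4                                                       ∎
  where
  open ℕ.≤-Reasoning
  open Bounded G r Δ≤ ω≤
  w : Fin n → ℕ
  w = weight ∘ d
  clique-weight : ∀ {A} → Kᵣ A → 2 ℕ.+ r ℕ.≤ sum (map w (members A))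
  clique-weight {A} K with light-vertices 4≤r K
  ... | x , _ , x∈A , _ , inj₁ (_ , dx≤1) = ℕ.+-cancelˡ-≤ 1 _ _ (begin
    -- A single vertex of weight 4 yields r + 3, one more than required.
    3 ℕ.+ r                             ≤⟨ ℕ.n≤1+n _ ⟩
    4 ℕ.+ r                             ≡⟨ ℕ.+-comm 4 r ⟩
    r ℕ.+ 4                             ≤⟨ ℕ.+-mono-≤ r≤ (ℕ.≤-trans (4≤weight dx≤1) (ℕ.m≤m+n _ 0)) ⟩
    ∣ A ∣ ℕ.+ sum (map w (x ∷ []))      ≤⟨ sum-members≥ w (1≤weight ∘ d) A (x ∷ []) ([] ∷ [])
                                             (λ { (here refl) → x∈A }) ⟩
    1 ℕ.+ sum (map w (members A))       ∎)
    where r≤ = ℕ.≤-reflexive (sym (proj₁ K))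
  ... | x , y , x∈A , y∈A , inj₂ (x≢y , dx≤2 , dy≤2) = ℕ.+-cancelˡ-≤ 2 _ _ (begin
    4 ℕ.+ r                             ≡⟨ ℕ.+-comm 4 r ⟩
    r ℕ.+ 4                             ≤⟨ ℕ.+-mono-≤ r≤ (ℕ.+-mono-≤ (2≤weight dx≤2)
                                             (ℕ.≤-trans (2≤weight dy≤2) (ℕ.m≤m+n _ 0))) ⟩
    ∣ A ∣ ℕ.+ sum (map w (x ∷ y ∷ []))  ≤⟨ sum-members≥ w (1≤weight ∘ d) A (x ∷ y ∷ []) ((x≢y ∷ []) ∷ [] ∷ [])
                                             (λ { (here refl) → x∈A ; (there (here refl)) → y∈A }) ⟩
    2 ℕ.+ sum (map w (members A))       ∎)
    where r≤ = ℕ.≤-reflexive (sym (proj₁ K))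

-- Turán graphs, their disjoint copies and the lower bound.

unique-map : (f : X → Y) {xs : List X} → (∀ {x y} → x ∈ˡ xs → y ∈ˡ xs → f x ≡ f y → x ≡ y) →
             Unique xs → Unique (map f xs)
unique-map f inj [] = []
unique-map f {x ∷ xs} inj (x∉xs ∷ u) =
  All.tabulate (λ fy∈ fx≡ → let y , y∈xs , fy≡ = ∈-map⁻ f fy∈ in
    All.lookup x∉xs y∈xs (inj (here refl) (there y∈xs) (trans fx≡ fy≡)))
  ∷ unique-map f (λ y∈ z∈ → inj (there y∈) (there z∈)) u

-- Used with positions to bound degrees and with colours, the residues modulo r, to bound cliques.
∣∣≤bound : (f : Fin n → ℕ) {m : ℕ} {S : Subset n} → (∀ {x y} → x ∈ S → y ∈ S → f x ≡ f y → x ≡ y) →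
           (∀ x → f x ℕ.< m) → ∣ S ∣ ℕ.≤ m
∣∣≤bound f {m} {S} inj f< = begin
  ∣ S ∣                      ≡⟨ length-members S ⟨
  length (members S)         ≡⟨ List.length-map f (members S) ⟨
  length (map f (members S)) ≤⟨ unique-⊆⇒length≤
                                  (unique-map f (λ x∈ y∈ → inj (∈-members⁻ x∈) (∈-members⁻ y∈)) (unique-members S))
                                  (λ y∈ → let x , _ , y≡ = ∈-map⁻ f y∈ in ∈-upTo⁺ (subst (ℕ._< m) (sym y≡) (f< x))) ⟩
  length (upTo m)            ≡⟨ List.length-upTo m ⟩
  m                          ∎
  where open ℕ.≤-Reasoning

length-cartesianProduct : (xs : List X) (ys : List Y) →
                          length (cartesianProduct xs ys) ≡ length xs ℕ.* length ys
length-cartesianProduct [] ys = refl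
length-cartesianProduct (x ∷ xs) ys = trans (List.length-++ (map (x ,_) ys))
  (cong₂ ℕ._+_ (List.length-map (x ,_) ys) (length-cartesianProduct xs ys))

≢⇒≡ᵇ-false : ∀ {a b} → a ≢ b → (a ≡ᵇ b) ≡ false
≢⇒≡ᵇ-false {a} {b} a≢b with a ≡ᵇ b in e
... | false = refl
... | true = contradiction (≡ᵇ⇒≡ a b (Equivalence.from T-≡ e)) a≢b

≡⇒≡ᵇ-true : ∀ {a b} → a ≡ b → (a ≡ᵇ b) ≡ true
≡⇒≡ᵇ-true {a} {b} a≡b = Equivalence.to T-≡ (≡⇒≡ᵇ a b a≡b)

≡ᵇ-true⇒≡ : ∀ {a b} → (a ≡ᵇ b) ≡ true → a ≡ b
≡ᵇ-true⇒≡ {a} {b} e = ≡ᵇ⇒≡ a b (Equivalence.from T-≡ e)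

-- A disjoint union of subgraphs of T_r(r+2): vertex i sits at position pos i of copy blk i.
module Blocks (r : ℕ) .{{_ : NonZero r}} (G : Graph n) (blk pos : Fin n → ℕ)
    (pos< : ∀ i → pos i ℕ.< 2 ℕ.+ r)
    (blk-pos-injective : ∀ {i j} → blk i ≡ blk j → pos i ≡ pos j → i ≡ j)
    (adj≡ : ∀ i j → adj G i j ≡ (blk i ≡ᵇ blk j) ∧ not ((pos i % r) ≡ᵇ (pos j % r))) where

  adj⇒same-block : ∀ {i j} → adj G i j ≡ true → blk i ≡ blk j
  adj⇒same-block {i} {j} a = ≡ᵇ-true⇒≡ (∧-conicalˡ _ _ (trans (sym (adj≡ i j)) a))

  adj⇒colours≢ : ∀ {i j} → adj G i j ≡ true → pos i % r ≢ pos j % r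
  adj⇒colours≢ {i} {j} a e with
    trans (sym (cong not (≡⇒≡ᵇ-true e))) (∧-conicalʳ (blk i ≡ᵇ blk j) _ (trans (sym (adj≡ i j)) a))
  ... | ()

  -- A closed neighbourhood stays in one block, where its vertices have distinct positions below r +
  -- 2. The vertices of a clique have distinct colours modulo r.
  inClass : InClass (suc r) r G
  inClass = (λ v → ℕ.≤-pred (ℕ.≤-trans (deg<∣nbhd∣ G v)
                (∣∣≤bound pos {S = nbhd G v}
                  (λ x∈ y∈ → blk-pos-injective (trans (sym (same-block {v} x∈)) (same-block {v} y∈))) pos<))) ,
            λ S c → ∣∣≤bound (λ i → pos i % r) (colours-injective (IsClique⇒Clique G {S} c)) (λ i → m%n<n (pos i) r)
    where
    same-block : ∀ {v x} → x ∈ nbhd G v → blk v ≡ blk x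
    same-block x∈ with ∈nbhd⁻ G x∈
    ... | inj₁ refl = refl
    ... | inj₂ a = adj⇒same-block a
    colours-injective : ∀ {S} → Clique G S → ∀ {x y} → x ∈ S → y ∈ S → pos x % r ≡ pos y % r → x ≡ y
    colours-injective c {x} {y} x∈ y∈ e with x ≟ y
    ... | yes x≡y = x≡y
    ... | no x≢y = contradiction e (adj⇒colours≢ (c x∈ y∈ x≢y))

  -- The map `vertex` witnesses that the first `m` blocks are complete; only their copies of K_r are
  -- counted.
  module Copies (4≤r : 4 ℕ.≤ r) (m : ℕ)
      (vertex : Fin m → ∀ {p} → p ℕ.< 2 ℕ.+ r → Fin n)
      (blk-vertex : ∀ c {p} (p< : p ℕ.< 2 ℕ.+ r) → blk (vertex c p<) ≡ toℕ c)
      (pos-vertex : ∀ c {p} (p< : p ℕ.< 2 ℕ.+ r) → pos (vertex c p<) ≡ p) where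

    -- The parts of T_r(r+2) with two elements are {0, r} and {1, r + 1}.
    choose : Bool → Bool → ℕ → ℕ
    choose α β 0 = if α then r else 0
    choose α β 1 = if β then suc r else 1
    choose α β x@(suc (suc _)) = x

    choose< : ∀ α β {x} → x ℕ.< r → choose α β x ℕ.< 2 ℕ.+ r
    choose< true  β {0} x<r = ℕ.m≤n⇒m≤1+n ℕ.≤-refl
    choose< false β {0} x<r = s≤s z≤n
    choose< α true  {1} x<r = ℕ.≤-refl
    choose< α false {1} x<r = s≤s (s≤s z≤n)
    choose< α β {suc (suc _)} x<r = ℕ.m≤n⇒m≤1+n (ℕ.m≤n⇒m≤1+n x<r)

    choose% : ∀ α β {x} → x ℕ.< r → choose α β x % r ≡ x
    choose% true  β {0} x<r = n%n≡0 r
    choose% false β {0} x<r = m<n⇒m%n≡m x<r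
    choose% α true  {1} x<r = trans ([m+n]%n≡m%n 1 r) (m<n⇒m%n≡m x<r)
    choose% α false {1} x<r = m<n⇒m%n≡m x<r
    choose% α β {suc (suc _)} x<r = m<n⇒m%n≡m x<r

    -- One vertex from each part of block `c`; the two Booleans select from the two parts of size
    -- two, which gives four copies per block. A vertex belongs when it is the chosen representative
    -- of its own colour.
    transversal : Fin m × Bool × Bool → Subset n
    transversal (c , α , β) = tabulate (λ i → (blk i ≡ᵇ toℕ c) ∧ (pos i ≡ᵇ choose α β (pos i % r)))

    blk-∈ : ∀ {c αβ i} → i ∈ transversal (c , αβ) → blk i ≡ toℕ c
    blk-∈ {i = i} i∈ = ≡ᵇ-true⇒≡ (∧-conicalˡ (blk i ≡ᵇ _) _ (∈-fromᵇ⁻ i∈))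

    pos-∈ : ∀ {c α β i} → i ∈ transversal (c , α , β) → pos i ≡ choose α β (pos i % r)
    pos-∈ {c} {i = i} i∈ = ≡ᵇ-true⇒≡ (∧-conicalʳ (blk i ≡ᵇ toℕ c) _ (∈-fromᵇ⁻ i∈))

    chosen : Fin m → Bool → Bool → Fin r → Fin n
    chosen c α β x = vertex c (choose< α β (Fin.toℕ<n x))

    pos-chosen% : ∀ c α β x → pos (chosen c α β x) % r ≡ toℕ x
    pos-chosen% c α β x = trans (cong (_% r) (pos-vertex c _)) (choose% α β (Fin.toℕ<n x))

    chosen-∈ : ∀ c α β x → chosen c α β x ∈ transversal (c , α , β)
    chosen-∈ c α β x = ∈-fromᵇ⁺ (cong₂ _∧_ (≡⇒≡ᵇ-true (blk-vertex c _))
      (≡⇒≡ᵇ-true (trans (pos-vertex c _) (cong (choose α β) (sym (pos-chosen% c α β x))))))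

    transversal-clique : ∀ cαβ → Clique G (transversal cαβ)
    transversal-clique (c , α , β) {i} {j} i∈ j∈ i≢j = trans (adj≡ i j) (cong₂ _∧_
      (≡⇒≡ᵇ-true blk≡)
      (cong not (≢⇒≡ᵇ-false {pos i % r} {pos j % r} λ e → i≢j (blk-pos-injective blk≡
        (trans (pos-∈ i∈) (trans (cong (choose α β) e) (sym (pos-∈ j∈))))))))
      where
      blk≡ : blk i ≡ blk j
      blk≡ = trans (blk-∈ i∈) (sym (blk-∈ j∈))

    -- At most r vertices because it is a clique in a graph of the class, at least r because each
    -- colour is represented.
    transversal-IsK : ∀ cαβ → IsK G r (transversal cαβ)
    transversal-IsK t@(c , α , β) = ℕ.≤-antisym
      (proj₂ inClass (transversal t) (Clique⇒IsClique G (transversal-clique t)))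
      (subst (ℕ._≤ ∣ transversal t ∣)
        (trans (List.length-map (chosen c α β) (allFin r)) (List.length-tabulate {n = r} id))
        (unique⇒length≤∣∣ {xs = map (chosen c α β) (allFin r)}
          (Unique.map⁺ (λ {x} {y} e → Fin.toℕ-injective
            (trans (sym (pos-chosen% c α β x)) (trans (cong (λ i → pos i % r) e) (pos-chosen% c α β y))))
            (Unique.allFin⁺ r))
          (λ i∈ → let x , _ , i≡ = ∈-map⁻ (chosen c α β) i∈ in
            subst (_∈ transversal t) (sym i≡) (chosen-∈ c α β x))))
      , transversal-clique t

    -- A chosen vertex of the first set lies in the second, so both choices dictate its position.
    -- The vertex of colour 0 reveals the block and the first Boolean, that of colour 1 the second
    -- Boolean.
    transversal-injective : ∀ {s t} → transversal s ≡ transversal t → s ≡ t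
    transversal-injective {c , α , β} {c′ , α′ , β′} e =
      cong₂ _,_
        (Fin.toℕ-injective (trans (sym (blk-vertex c _)) (blk-∈ (shared colour₀))))
        (cong₂ _,_ (first α α′ (same-choice colour₀ toℕ-colour₀)) (second β β′ (same-choice colour₁ toℕ-colour₁)))
      where
      colour₀ colour₁ : Fin r
      colour₀ = fromℕ< {0} (ℕ.≤-trans (s≤s z≤n) 4≤r)
      colour₁ = fromℕ< {1} (ℕ.≤-trans (s≤s (s≤s z≤n)) 4≤r)
      toℕ-colour₀ : toℕ colour₀ ≡ 0
      toℕ-colour₀ = Fin.toℕ-fromℕ< _
      toℕ-colour₁ : toℕ colour₁ ≡ 1
      toℕ-colour₁ = Fin.toℕ-fromℕ< _
      shared : ∀ x → chosen c α β x ∈ transversal (c′ , α′ , β′)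
      shared x = subst (chosen c α β x ∈_) e (chosen-∈ c α β x)
      same-choice : ∀ x {y} → toℕ x ≡ y → choose α β y ≡ choose α′ β′ y
      same-choice x refl = trans (sym (pos-vertex c _))
        (trans (pos-∈ {α = α′} {β = β′} (shared x)) (cong (choose α′ β′) (pos-chosen% c α β x)))
      r≢0 : r ≢ 0
      r≢0 = ℕ.≢-nonZero⁻¹ r
      first : ∀ α α′ → (if α then r else 0) ≡ (if α′ then r else 0) → α ≡ α′
      first true true _ = refl
      first false false _ = refl
      first true false r≡0 = contradiction r≡0 r≢0
      first false true 0≡r = contradiction (sym 0≡r) r≢0
      second : ∀ β β′ → (if β then suc r else 1) ≡ (if β′ then suc r else 1) → β ≡ β′
      second true true _ = refl
      second false false _ = refl
      second true false e = contradiction (ℕ.suc-injective e) r≢0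
      second false true e = contradiction (sym (ℕ.suc-injective e)) r≢0

    m*4≤k : m ℕ.* 4 ℕ.≤ k r G
    m*4≤k = begin
      m ℕ.* 4                         ≡⟨ cong (ℕ._* 4) (List.length-tabulate {n = m} id) ⟨
      length (allFin m) ℕ.* 4         ≡⟨ length-cartesianProduct (allFin m) choices ⟨
      length indices                  ≡⟨ List.length-map transversal indices ⟨
      length (map transversal indices) ≤⟨ unique-⊆⇒length≤
        (Unique.map⁺ transversal-injective (Unique.cartesianProduct⁺ (Unique.allFin⁺ m) unique-choices))
        (λ S∈ → let t , _ , S≡ = ∈-map⁻ transversal S∈ in
          ∈-cliques⁺ G (subst (IsK G r) (sym S≡) (transversal-IsK t))) ⟩
      k r G                           ∎
      where
      open ℕ.≤-Reasoning
      bools : List Bool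
      bools = true ∷ false ∷ []
      choices = cartesianProduct bools bools
      indices = cartesianProduct (allFin m) choices
      unique-bools : Unique bools
      unique-bools = ((λ ()) ∷ []) ∷ [] ∷ []
      unique-choices : Unique choices
      unique-choices = Unique.cartesianProduct⁺ unique-bools unique-bools

-- The upper bound at n = r + 2 gives at most 4 after cancelling r + 2; viewing the graph as a
-- single complete block gives at least 4.
k-turán : (r : ℕ) .{{_ : NonZero r}} → 4 ℕ.≤ r → k r (turán r (2 ℕ.+ r)) ≡ 4
k-turán r 4≤r = ℕ.≤-antisym
  (ℕ.*-cancelʳ-≤ _ _ (2 ℕ.+ r)
    (ℕ.≤-trans (k*[r+2]≤n*4 (turán r (2 ℕ.+ r)) 4≤r inClass) (ℕ.≤-reflexive (ℕ.*-comm (2 ℕ.+ r) 4))))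
  m*4≤k
  where
  open Blocks r (turán r (2 ℕ.+ r)) (λ _ → 0) toℕ Fin.toℕ<n (λ _ → Fin.toℕ-injective) (λ _ _ → refl)
  vertex : Fin 1 → ∀ {p} → p ℕ.< 2 ℕ.+ r → Fin (2 ℕ.+ r)
  vertex _ p< = fromℕ< p<
  blk-vertex : ∀ c {p} (p< : p ℕ.< 2 ℕ.+ r) → 0 ≡ toℕ c
  blk-vertex zero _ = refl
  pos-vertex : ∀ c {p} (p< : p ℕ.< 2 ℕ.+ r) → toℕ (vertex c p<) ≡ p
  pos-vertex _ p< = Fin.toℕ-fromℕ< p<
  open Copies 4≤r 1 vertex blk-vertex pos-vertex

-- Quotient and remainder modulo r + 2 give the block and the position, so the construction makes
-- sense for every `n`, with a possibly truncated last block.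
copies : (r : ℕ) .{{_ : NonZero r}} (n : ℕ) → Graph n
copies r n = record
  { adj = λ i j → (toℕ i ℕ./ b ≡ᵇ toℕ j ℕ./ b) ∧ not ((toℕ i % b % r) ≡ᵇ (toℕ j % b % r))
  ; adj-sym = λ i j → cong₂ _∧_ (≡ᵇ-comm (toℕ i ℕ./ b) (toℕ j ℕ./ b))
      (cong not (≡ᵇ-comm (toℕ i % b % r) (toℕ j % b % r)))
  ; adj-irrefl = λ i → trans
      (cong (λ c → (toℕ i ℕ./ b ≡ᵇ toℕ i ℕ./ b) ∧ not c) (≡⇒≡ᵇ-true {toℕ i % b % r} refl)) (∧-zeroʳ _)
  }
  where
  b = 2 ℕ.+ r
  ≡ᵇ-comm : ∀ x y → (x ≡ᵇ y) ≡ (y ≡ᵇ x)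
  ≡ᵇ-comm x y with x ℕ.≟ y
  ... | yes refl = refl
  ... | no x≢y = trans (≢⇒≡ᵇ-false x≢y) (sym (≢⇒≡ᵇ-false (x≢y ∘ sym)))

module _ (r : ℕ) .{{_ : NonZero r}} (n : ℕ) where
  private
    b = 2 ℕ.+ r
    blk pos : Fin n → ℕ
    blk i = toℕ i ℕ./ b
    pos i = toℕ i % b
    blk-pos-injective : ∀ {i j} → blk i ≡ blk j → pos i ≡ pos j → i ≡ j
    blk-pos-injective {i} {j} e e′ = Fin.toℕ-injective (begin
      toℕ i                        ≡⟨ m≡m%n+[m/n]*n (toℕ i) b ⟩
      pos i ℕ.+ blk i ℕ.* b        ≡⟨ cong₂ (λ p c → p ℕ.+ c ℕ.* b) e′ e ⟩
      pos j ℕ.+ blk j ℕ.* b        ≡⟨ m≡m%n+[m/n]*n (toℕ j) b ⟨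
      toℕ j                        ∎)
      where open ≡-Reasoning

  open Blocks r (copies r n) blk pos (λ i → m%n<n (toℕ i) b) blk-pos-injective (λ _ _ → refl)

  copies-inClass : InClass (suc r) r (copies r n)
  copies-inClass = inClass

  k-copies : 4 ℕ.≤ r → n ℕ./ b ℕ.* 4 ℕ.≤ k r (copies r n)
  k-copies 4≤r = m*4≤k
    where
    index< : (c : Fin (n ℕ./ b)) → ∀ {p} → p ℕ.< b → p ℕ.+ toℕ c ℕ.* b ℕ.< n
    index< c {p} p<b = begin-strict
      p ℕ.+ toℕ c ℕ.* b    <⟨ ℕ.+-monoˡ-< (toℕ c ℕ.* b) p<b ⟩
      suc (toℕ c) ℕ.* b    ≤⟨ ℕ.*-monoˡ-≤ b (Fin.toℕ<n c) ⟩
      n ℕ./ b ℕ.* b        ≤⟨ m/n*n≤m n b ⟩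
      n                    ∎
      where open ℕ.≤-Reasoning
    vertex : Fin (n ℕ./ b) → ∀ {p} → p ℕ.< b → Fin n
    vertex c p<b = fromℕ< (index< c p<b)
    blk-vertex : ∀ c {p} (p<b : p ℕ.< b) → blk (vertex c p<b) ≡ toℕ c
    blk-vertex c {p} p<b = begin
      toℕ (vertex c p<b) ℕ./ b              ≡⟨ /-congˡ (Fin.toℕ-fromℕ< (index< c p<b)) ⟩
      (p ℕ.+ toℕ c ℕ.* b) ℕ./ b             ≡⟨ +-distrib-/-∣ʳ p (n∣m*n (toℕ c)) ⟩
      p ℕ./ b ℕ.+ toℕ c ℕ.* b ℕ./ b         ≡⟨ cong₂ ℕ._+_ (m<n⇒m/n≡0 p<b) (m*n/n≡m (toℕ c) b) ⟩
      toℕ c                                 ∎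
      where open ≡-Reasoning
    pos-vertex : ∀ c {p} (p<b : p ℕ.< b) → pos (vertex c p<b) ≡ p
    pos-vertex c {p} p<b = begin
      toℕ (vertex c p<b) % b                ≡⟨ %-congˡ {o = b} (Fin.toℕ-fromℕ< (index< c p<b)) ⟩
      (p ℕ.+ toℕ c ℕ.* b) % b               ≡⟨ [m+kn]%n≡m%n p (toℕ c) b ⟩
      p % b                                 ≡⟨ m<n⇒m%n≡m p<b ⟩
      p                                     ∎
      where open ≡-Reasoning
    open Copies 4≤r (n ℕ./ b) vertex blk-vertex pos-vertex

  -- The remainder block has fewer than `b` vertices, so it costs at most 4 compared with the ideal
  -- count 4n/b. The inequality is kept free of denominators.
  n*4≤[k+4]*b : 4 ℕ.≤ r → n ℕ.* 4 ℕ.≤ (k r (copies r n) ℕ.+ 4) ℕ.* b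
  n*4≤[k+4]*b 4≤r = begin
    n ℕ.* 4                                 ≡⟨ cong (ℕ._* 4) (m≡m%n+[m/n]*n n b) ⟩
    (n % b ℕ.+ n ℕ./ b ℕ.* b) ℕ.* 4         ≤⟨ ℕ.*-monoˡ-≤ 4 (ℕ.+-monoˡ-≤ (n ℕ./ b ℕ.* b) (m%n≤n n b)) ⟩
    (b ℕ.+ n ℕ./ b ℕ.* b) ℕ.* 4             ≡⟨ rearrange (n ℕ./ b) b ⟩
    (n ℕ./ b ℕ.* 4 ℕ.+ 4) ℕ.* b             ≤⟨ ℕ.*-monoˡ-≤ b (ℕ.+-monoˡ-≤ 4 (k-copies 4≤r)) ⟩
    (k r (copies r n) ℕ.+ 4) ℕ.* b          ∎
    where
    open ℕ.≤-Reasoning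
    rearrange : ∀ q b → (b ℕ.+ q ℕ.* b) ℕ.* 4 ≡ (q ℕ.* 4 ℕ.+ 4) ℕ.* b
    rearrange = solve-∀

-- Rational estimates and the limit.

-- Since `_/_` reduces to lowest terms, the comparison passes to unnormalised fractions, where it is
-- cross-multiplication.
/-mono-≤ℚ : ∀ a b c d → a ℕ.* suc d ℕ.≤ c ℕ.* suc b → (+ a) / suc b ℚ.≤ (+ c) / suc d
/-mono-≤ℚ a b c d h = ℚ.toℚᵘ-cancel-≤ (begin
  toℚᵘ ((+ a) / suc b)   ≃⟨ ℚ.toℚᵘ-fromℚᵘ (mkℚᵘ (+ a) b) ⟩
  mkℚᵘ (+ a) b           ≤⟨ *≤* (subst₂ ℤ._≤_ (ℤ.pos-* a (suc d)) (ℤ.pos-* c (suc b)) (ℤ.+≤+ h)) ⟩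
  mkℚᵘ (+ c) d           ≃⟨ ℚ.toℚᵘ-fromℚᵘ (mkℚᵘ (+ c) d) ⟨
  toℚᵘ ((+ c) / suc d)   ∎)
  where open ℚᵘ.≤-Reasoning

p≤q+ε⇒p-ε≤q : ∀ {p q ε} → p ℚ.≤ q ℚ.+ ε → p ℚ.- ε ℚ.≤ q
p≤q+ε⇒p-ε≤q {p} {q} {ε} h = begin
  p ℚ.- ε             ≤⟨ ℚ.+-monoˡ-≤ (ℚ.- ε) h ⟩
  q ℚ.+ ε ℚ.- ε       ≡⟨ ℚ.+-assoc q ε (ℚ.- ε) ⟩
  q ℚ.+ (ε ℚ.- ε)     ≡⟨ cong (q ℚ.+_) (ℚ.+-inverseʳ ε) ⟩
  q ℚ.+ 0ℚ            ≡⟨ ℚ.+-identityʳ q ⟩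
  q                   ∎
  where open ℚ.≤-Reasoning

p≤p+ε : ∀ {p ε} → 0ℚ ℚ.< ε → p ℚ.≤ p ℚ.+ ε
p≤p+ε {p} {ε} 0<ε = subst (ℚ._≤ p ℚ.+ ε) (ℚ.+-identityʳ p) (ℚ.+-monoʳ-≤ p (ℚ.<⇒≤ 0<ε))

-- A positive rational has numerator at least 1, so its own denominator serves as the witness.
unitFraction≤ : ∀ {ε} → 0ℚ ℚ.< ε → ∃[ e ] (+ 1) / suc e ℚ.≤ ε
unitFraction≤ {ε@(mkℚ +[1+ a ] e _)} 0<ε = e ,
  subst ((+ 1) / suc e ℚ.≤_) (ℚ.fromℚᵘ-toℚᵘ ε) (/-mono-≤ℚ 1 e (suc a) e (ℕ.*-monoˡ-≤ (suc e) (s≤s (z≤n {a}))))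
unitFraction≤ {mkℚ (+ 0) _ _} 0<ε with ℚ.positive 0<ε
... | ()
unitFraction≤ {mkℚ -[1+ _ ] _ _} 0<ε with ℚ.positive 0<ε
... | ()

/-distrib-+ : ∀ a c d → (+ (a ℕ.+ c)) / suc d ≡ (+ a) / suc d ℚ.+ (+ c) / suc d
/-distrib-+ a c d = ℚ.toℚᵘ-injective (begin
  toℚᵘ ((+ (a ℕ.+ c)) / suc d)                        ≈⟨ ℚ.toℚᵘ-fromℚᵘ (mkℚᵘ (+ (a ℕ.+ c)) d) ⟩
  mkℚᵘ (+ (a ℕ.+ c)) d                                ≈⟨ ℚᵘ.*≡* cross ⟩
  mkℚᵘ (+ a) d ℚᵘ.+ mkℚᵘ (+ c) d                      ≈⟨ ℚᵘ.+-cong (ℚ.toℚᵘ-fromℚᵘ (mkℚᵘ (+ a) d)) (ℚ.toℚᵘ-fromℚᵘ (mkℚᵘ (+ c) d)) ⟨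
  toℚᵘ ((+ a) / suc d) ℚᵘ.+ toℚᵘ ((+ c) / suc d)      ≈⟨ ℚ.toℚᵘ-homo-+ ((+ a) / suc d) ((+ c) / suc d) ⟨
  toℚᵘ ((+ a) / suc d ℚ.+ (+ c) / suc d)              ∎)
  where
  open ℚᵘ.≃-Reasoning
  cross : + (a ℕ.+ c) ℤ.* + (suc d ℕ.* suc d) ≡ (+ a ℤ.* + suc d ℤ.+ + c ℤ.* + suc d) ℤ.* + suc d
  cross = trans (cong (+ (a ℕ.+ c) ℤ.*_) (ℤ.pos-* (suc d) (suc d)))
    (trans (sym (ℤ.*-assoc (+ (a ℕ.+ c)) (+ suc d) (+ suc d)))
      (cong (ℤ._* + suc d) (ℤ.*-distribʳ-+ (+ suc d) (+ a) (+ c))))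

-- The limit is unfolded: a bound for all admissible graphs and one nearly optimal graph place the
-- maximum of `ρ` within `ε` of 4/(r+2). The order is written `suc m` to keep the denominator
-- nonzero.
theorem5p3 : (r : ℕ) .{{_ : NonZero r}} → 4 Data.Nat.≤ r →
  (ρ r (turán r (2 Data.Nat.+ r)) ≡ (+ 4) / (2 Data.Nat.+ r))
  × ((ε : ℚ) → 0ℚ < ε → Σ ℕ λ N → (m : ℕ) → N Data.Nat.≤ suc m →
      ((G : Graph (suc m)) → InClass (suc r) r G → ρ r G Data.Rational.≤ ((+ 4) / (2 Data.Nat.+ r)) Data.Rational.+ ε)
      × (Σ (Graph (suc m)) λ G → InClass (suc r) r G × (((+ 4) / (2 Data.Nat.+ r)) - ε Data.Rational.≤ ρ r G)))
theorem5p3 r 4≤r = cong (λ c → (+ c) / (2 ℕ.+ r)) (k-turán r 4≤r) , limit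
  where
  limit : ∀ ε → 0ℚ ℚ.< ε → _
  limit ε 0<ε with unitFraction≤ 0<ε
  -- The loss of 4 copies in `n*4≤[k+4]*b` becomes 4/n, which is at most 1/(e+1) once n ≥ 4(e+1).
  ... | e , 1/e≤ε = 4 ℕ.* suc e , λ m N≤ →
    (λ G G∈ → ℚ.≤-trans
      (/-mono-≤ℚ (k r G) m 4 (suc r)
        (ℕ.≤-trans (k*[r+2]≤n*4 G 4≤r G∈) (ℕ.≤-reflexive (ℕ.*-comm (suc m) 4))))
      (p≤p+ε 0<ε)) ,
    copies r (suc m) , copies-inClass r (suc m) , p≤q+ε⇒p-ε≤q (lower m N≤)
    where
    open ℚ.≤-Reasoning
    lower : ∀ m → 4 ℕ.* suc e ℕ.≤ suc m → (+ 4) / (2 ℕ.+ r) ℚ.≤ ρ r (copies r (suc m)) ℚ.+ ε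
    lower m N≤ = begin
      (+ 4) / (2 ℕ.+ r)                 ≤⟨ /-mono-≤ℚ 4 (suc r) (kᵣ ℕ.+ 4) m
                                             (subst (ℕ._≤ (kᵣ ℕ.+ 4) ℕ.* (2 ℕ.+ r)) (ℕ.*-comm (suc m) 4)
                                               (n*4≤[k+4]*b r (suc m) 4≤r)) ⟩
      (+ (kᵣ ℕ.+ 4)) / suc m            ≡⟨ /-distrib-+ kᵣ 4 m ⟩
      ρᵣ ℚ.+ (+ 4) / suc m              ≤⟨ ℚ.+-monoʳ-≤ ρᵣ (/-mono-≤ℚ 4 m 1 e
                                             (subst (4 ℕ.* suc e ℕ.≤_) (sym (ℕ.+-identityʳ (suc m))) N≤)) ⟩
      ρᵣ ℚ.+ (+ 1) / suc e              ≤⟨ ℚ.+-monoʳ-≤ ρᵣ 1/e≤ε ⟩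
      ρᵣ ℚ.+ ε                          ∎
      where
      kᵣ = k r (copies r (suc m))
      ρᵣ = ρ r (copies r (suc m))
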